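{- If $G$ is a graph containing a cycle, with girth $g(G)$, then $L_1(G)\geq \left\lfloor\frac{g(G)}{3}\right\rfloor$. Moreover, the lower bound is tight, i.e. there exist graphs for which equality holds.
   Context: All graphs are finite, undirected, simple and nontrivial (at least two vertices). The girth $g(G)$ is the length of a shortest cycle in $G$. $N[v]=\{v\}\cup N(v)$ is the closed neighbourhood of $v$. A set $B\subseteq V(G)$ is a $1$-limited packing if $|N[v]\cap B|\le 1$ for every vertex $v$ of $G$; $L_1(G)$ is the maximum cardinality of a $1$-limited packing in $G$. -}

module Defs where

open import Data.Empty using (⊥)
open import Data.Fin using (Fin; _≟_)
open import Data.Fin.Properties using (all?; any?)
open import Data.Fin.Subset using (Subset; _∩_; ∣_∣) renaming (⊥ to ∅)
open import Data.Fin.Subset.Properties using (anySubset?; ∣p∣≤n; ∣⊥∣≡0; p∩q⊆q; p⊆q⇒∣p∣≤∣q∣)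
open import Data.List using (List; []; _∷_; _∷ʳ_; length)
open import Data.List.Relation.Unary.Linked using (Linked; linked?)
open import Data.List.Relation.Unary.Unique.Propositional using (Unique)
import Data.List.Relation.Unary.Unique.DecPropositional as UniqueDec
open import Data.Nat using (ℕ; zero; suc; _≤_; _<_; z≤n; _≤?_) renaming (_≟_ to _≟ℕ_)
open import Data.Nat.Induction using (<-rec)
open import Data.Nat.Properties using (anyUpTo?; ≮⇒≥; ≤∧≢⇒<; ≤-pred; ≤-trans; ≤-reflexive)
open import Data.Product using (∃; _×_; _,_; proj₁; proj₂)
open import Data.Vec using (tabulate)
open import Level using (0ℓ)
open import Relation.Binary.Core using (Rel)
open import Relation.Binary.Definitions using (Decidable; Symmetric)
open import Relation.Binary.PropositionalEquality using (_≡_; refl; cong)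
open import Relation.Nullary using (¬_; Dec; yes; no; does)
open import Relation.Nullary.Decidable using (map′; _×-dec_; _⊎-dec_)
import Relation.Unary as U

record Graph : Set₁ where
  field
    order      : ℕ
    nontrivial : 2 ≤ order
    Adj        : Rel (Fin order) 0ℓ
    adj?       : Decidable Adj
    adj-sym    : Symmetric Adj
    adj-irrefl : ∀ v → ¬ Adj v v

  Vertex : Set
  Vertex = Fin order

module _ (G : Graph) where
  open Graph G

  -- A cycle is the list of its vertices in cyclic order; the first vertex
  -- is repeated at the end only to express adjacency around the cycle.
  IsCycle : List Vertex → Set
  IsCycle []       = ⊥
  IsCycle (x ∷ xs) =
    3 ≤ length (x ∷ xs) × Unique (x ∷ xs) × Linked Adj ((x ∷ xs) ∷ʳ x)

  ContainsCycle : Set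
  ContainsCycle = ∃ IsCycle

  HasCycleOfLength : ℕ → Set
  HasCycleOfLength k = ∃ λ c → IsCycle c × length c ≡ k

  IsGirth : ℕ → Set
  IsGirth g = HasCycleOfLength g × (∀ k → HasCycleOfLength k → g ≤ k)

  N[_] : Vertex → Subset order
  N[ v ] = tabulate λ u → does ((u ≟ v) ⊎-dec adj? v u)

  Is1LimitedPacking : Subset order → Set
  Is1LimitedPacking B = ∀ v → ∣ N[ v ] ∩ B ∣ ≤ 1

  HasPackingOfSize : ℕ → Set
  HasPackingOfSize k = ∃ λ B → Is1LimitedPacking B × ∣ B ∣ ≡ k

  IsMaxPackingSize : ℕ → Set
  IsMaxPackingSize m = HasPackingOfSize m × (∀ k → HasPackingOfSize k → k ≤ m)

-- girth and L₁ below are computed by bounded search; girth-isGirth and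
-- L₁-isMax characterise their values uniquely, so girth does not depend on
-- which cycle is supplied.

least : {P : ℕ → Set} → U.Decidable P → ∀ n → P n →
        ∃ λ m → P m × (∀ k → P k → m ≤ k)
least {P} P? = <-rec (λ n → P n → ∃ λ m → P m × (∀ k → P k → m ≤ k)) step
  where
  step : ∀ n → (∀ {i} → i < n → P i → ∃ λ m → P m × (∀ k → P k → m ≤ k)) →
         P n → ∃ λ m → P m × (∀ k → P k → m ≤ k)
  step n rec pn with anyUpTo? P? n
  ... | yes (i , i<n , pi) = rec i<n pi
  ... | no ∄i = n , pn , λ k pk → ≮⇒≥ λ k<n → ∄i (k , k<n , pk)

greatest : {P : ℕ → Set} → U.Decidable P → P 0 → ∀ n → (∀ k → P k → k ≤ n) →
           ∃ λ m → P m × (∀ k → P k → k ≤ m)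
greatest P? p0 zero    bound = 0 , p0 , bound
greatest {P} P? p0 (suc n) bound with P? (suc n)
... | yes p = suc n , p , bound
... | no ¬p = greatest P? p0 n λ k pk →
  ≤-pred (≤∧≢⇒< (bound k pk) λ { refl → ¬p pk })

anyListOfLength? : ∀ {n} {P : List (Fin n) → Set} → U.Decidable P →
                   ∀ k → Dec (∃ λ xs → P xs × length xs ≡ k)
anyListOfLength? P? zero =
  map′ (λ p → [] , p , refl) (λ { ([] , p , _) → p }) (P? [])
anyListOfLength? P? (suc k) =
  map′ (λ { (x , xs , p , eq) → x ∷ xs , p , cong suc eq })
       (λ { (x ∷ xs , p , refl) → x , xs , p , refl })
       (any? λ x → anyListOfLength? (λ xs → P? (x ∷ xs)) k)

module _ (G : Graph) where
  open Graph G

  isCycle? : U.Decidable (IsCycle G)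
  isCycle? []       = no λ ()
  isCycle? (x ∷ xs) =
    (3 ≤? length (x ∷ xs)) ×-dec UniqueDec.unique? _≟_ (x ∷ xs)
      ×-dec linked? adj? ((x ∷ xs) ∷ʳ x)

  girth-exists : ContainsCycle G → ∃ (IsGirth G)
  girth-exists (c , isCycle) =
    least (anyListOfLength? isCycle?) (length c) (c , isCycle , refl)

  girth : ContainsCycle G → ℕ
  girth c = proj₁ (girth-exists c)

  girth-isGirth : (c : ContainsCycle G) → IsGirth G (girth c)
  girth-isGirth c = proj₂ (girth-exists c)

  hasPackingOfSize? : U.Decidable (HasPackingOfSize G)
  hasPackingOfSize? k = anySubset? λ B →
    all? (λ v → ∣ N[_] G v ∩ B ∣ ≤? 1) ×-dec (∣ B ∣ ≟ℕ k)

  ∅-packing : HasPackingOfSize G 0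
  ∅-packing = ∅ , (λ v → ≤-trans (p⊆q⇒∣p∣≤∣q∣ (p∩q⊆q (N[_] G v) ∅))
                           (≤-trans (≤-reflexive (∣⊥∣≡0 order)) z≤n))
                , ∣⊥∣≡0 order

  L₁-exists : ∃ (IsMaxPackingSize G)
  L₁-exists = greatest hasPackingOfSize? ∅-packing order
    λ { k (B , _ , refl) → ∣p∣≤n B }

  L₁ : ℕ
  L₁ = proj₁ L₁-exists

  L₁-isMax : IsMaxPackingSize G L₁
  L₁-isMax = proj₂ L₁-exists

{-# OPTIONS --safe #-}

-- On a shortest cycle, of length g, choose every third vertex, starting from
-- one end of its vertex list and leaving at least two vertices after the last
-- choice.  Two chosen vertices u and w bound a segment of the cycle with at
-- least two interior vertices and at most g - 2 vertices in total.  If both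
-- were in N[v], then u and w would be adjacent and close the segment to a
-- cycle, or v would close it as an extra vertex, or v would lie inside it and
-- close a part of it; each of these cycles is shorter than g.  The triangle
-- attains the bound.
module Submission where

open import Defs
open import Data.Bool using (true)
open import Data.Fin using (Fin; zero; suc; _≟_)
open import Data.Fin.Subset using (Subset; _∈_; _⊂_; _∪_; ⁅_⁆; ∣_∣) renaming (⊥ to ∅)
open import Data.Fin.Subset.Properties
  using (nonempty?; Empty-unique; ∣⊥∣≡0; ∣⁅x⁆∣≡1; p⊆q⇒∣p∣≤∣q∣; p⊂q⇒∣p∣<∣q∣; x∈⁅x⁆;
         x∈⁅y⁆⇒x≡y; x∈p∪q⁺; x∈p∪q⁻; x∈p∩q⁻; q⊆p∪q; ∉⊥)
open import Data.List using (List; []; _∷_; [_]; _++_; length; foldr)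
open import Data.List.Membership.DecPropositional using (_∈?_)
open import Data.List.Membership.Propositional
  using () renaming (_∈_ to _∈ˡ_; _∉_ to _∉ˡ_)
open import Data.List.Membership.Propositional.Properties using (∈-++⁺ʳ; ∈-∃++; ∈-++⁻)
open import Data.List.Properties using (length-++; ++-assoc)
open import Data.List.Relation.Unary.All using ([]; _∷_; lookup; tabulate)
import Data.List.Relation.Unary.All.Properties as All
open import Data.List.Relation.Unary.AllPairs as AllPairs using (AllPairs; []; _∷_)
open import Data.List.Relation.Unary.Any using (here; there)
open import Data.List.Relation.Unary.Linked using (Linked; []; [-]; _∷_)
open import Data.List.Relation.Unary.Unique.Propositional using (Unique)
open import Data.Nat using (ℕ; suc; _+_; _≤_; _/_; z≤n; s≤s)
open import Data.Nat.DivMod using (m/n≡1+[m∸n]/n)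
open import Data.Nat.Properties
  using (≤-refl; ≤-trans; ≤-reflexive; <⇒≱; +-comm; +-monoʳ-≤; m≤m+n; m≤n+m; n≤1+n;
         module ≤-Reasoning)
open import Data.Product using (_×_; Σ; ∃; ∃₂; _,_; proj₂)
open import Data.Sum using (_⊎_; inj₁; inj₂)
open import Data.Vec.Properties using ([]=⇒lookup; lookup∘tabulate)
open import Relation.Binary.Core using (Rel)
open import Relation.Binary.PropositionalEquality
  using (_≡_; _≢_; refl; sym; trans; cong; subst; ≢-sym)
open import Relation.Nullary using (¬_; Dec; yes; no; does; contradiction)
open import Relation.Nullary.Decidable using (¬?; from-yes; _⊎-dec_)

module _ {A : Set} where

  length-++-[] : ∀ (xs : List A) {y} → length (xs ++ [ y ]) ≡ suc (length xs)
  length-++-[] xs = trans (length-++ xs) (+-comm (length xs) 1)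

  module _ {ℓ} {R : Rel A ℓ} where

    Linked-++⁻ˡ : ∀ xs {ys} → Linked R (xs ++ ys) → Linked R xs
    Linked-++⁻ˡ []           _       = []
    Linked-++⁻ˡ (x ∷ [])     _       = [-]
    Linked-++⁻ˡ (x ∷ y ∷ xs) (r ∷ l) = r ∷ Linked-++⁻ˡ (y ∷ xs) l

    Linked-tail : ∀ {x xs} → Linked R (x ∷ xs) → Linked R xs
    Linked-tail [-]     = []
    Linked-tail (_ ∷ l) = l

    Linked-++⁻ʳ : ∀ xs {ys} → Linked R (xs ++ ys) → Linked R ys
    Linked-++⁻ʳ []       l = l
    Linked-++⁻ʳ (x ∷ xs) l = Linked-++⁻ʳ xs (Linked-tail l)

    Linked-∷ʳ⁺ : ∀ xs {y z} → Linked R (xs ++ [ y ]) → R y z →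
                 Linked R ((xs ++ [ y ]) ++ [ z ])
    Linked-∷ʳ⁺ []           _       r = r ∷ [-]
    Linked-∷ʳ⁺ (x ∷ [])     (s ∷ _) r = s ∷ r ∷ [-]
    Linked-∷ʳ⁺ (x ∷ y ∷ xs) (s ∷ l) r = s ∷ Linked-∷ʳ⁺ (y ∷ xs) l r

    AllPairs-++⁻ˡ : ∀ xs {ys} → AllPairs R (xs ++ ys) → AllPairs R xs
    AllPairs-++⁻ˡ []       _        = []
    AllPairs-++⁻ˡ (x ∷ xs) (p ∷ ps) = All.++⁻ˡ xs p ∷ AllPairs-++⁻ˡ xs ps

    AllPairs-++⁻ʳ : ∀ xs {ys} → AllPairs R (xs ++ ys) → AllPairs R ys
    AllPairs-++⁻ʳ []       ps       = ps
    AllPairs-++⁻ʳ (x ∷ xs) (_ ∷ ps) = AllPairs-++⁻ʳ xs ps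

    -- `R` need not be symmetric: the order of the two entries in the list decides which of the last
    -- two cases arises.
    AllPairs-lookup : ∀ {xs x y} → AllPairs R xs → x ∈ˡ xs → y ∈ˡ xs →
                      x ≡ y ⊎ R x y ⊎ R y x
    AllPairs-lookup (_ ∷ _)  (here refl) (here refl) = inj₁ refl
    AllPairs-lookup (p ∷ _)  (here refl) (there y∈)  = inj₂ (inj₁ (lookup p y∈))
    AllPairs-lookup (p ∷ _)  (there x∈)  (here refl) = inj₂ (inj₂ (lookup p x∈))
    AllPairs-lookup (_ ∷ ps) (there x∈)  (there y∈)  = AllPairs-lookup ps x∈ y∈

  -- An incomplete final block contributes nothing, so at least two entries follow every chosen one.
  -- On a cycle these keep the last choice away from the first.
  thirds : List A → List A
  thirds (x ∷ _ ∷ _ ∷ xs) = x ∷ thirds xs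
  thirds _                = []

  length-thirds : ∀ xs → length (thirds xs) ≡ length xs / 3
  length-thirds []               = refl
  length-thirds (_ ∷ [])         = refl
  length-thirds (_ ∷ _ ∷ [])     = refl
  length-thirds (_ ∷ _ ∷ _ ∷ xs) =
    trans (cong suc (length-thirds xs))
          (sym (m/n≡1+[m∸n]/n (m≤m+n 3 (length xs))))

  ∈-thirds : ∀ xs {w} → w ∈ˡ thirds xs →
             ∃₂ λ ps qs → xs ≡ ps ++ w ∷ qs × 2 ≤ length qs
  ∈-thirds (x ∷ y ∷ z ∷ xs) (here refl) = [] , y ∷ z ∷ xs , refl , s≤s (s≤s z≤n)
  ∈-thirds (x ∷ y ∷ z ∷ xs) (there w∈)
    with ps , qs , refl , 2≤ ← ∈-thirds xs w∈ = x ∷ y ∷ z ∷ ps , qs , refl , 2≤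

module _ {n : ℕ} where

  fromList : List (Fin n) → Subset n
  fromList = foldr (λ x p → ⁅ x ⁆ ∪ p) ∅

  ∈-fromList⁻ : ∀ xs {x} → x ∈ fromList xs → x ∈ˡ xs
  ∈-fromList⁻ []       x∈ = contradiction x∈ ∉⊥
  ∈-fromList⁻ (y ∷ ys) x∈ with x∈p∪q⁻ ⁅ y ⁆ (fromList ys) x∈
  ... | inj₁ x∈y  = here (x∈⁅y⁆⇒x≡y y x∈y)
  ... | inj₂ x∈ys = there (∈-fromList⁻ ys x∈ys)

  length≤∣fromList∣ : ∀ {xs} → Unique xs → length xs ≤ ∣ fromList xs ∣
  length≤∣fromList∣ []                        = z≤n
  length≤∣fromList∣ {x ∷ xs} (x≢xs ∷ unique) =
    ≤-trans (s≤s (length≤∣fromList∣ unique)) (p⊂q⇒∣p∣<∣q∣ strict)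
    where
    strict : fromList xs ⊂ fromList (x ∷ xs)
    strict = q⊆p∪q ⁅ x ⁆ (fromList xs) , x , x∈p∪q⁺ (inj₁ (x∈⁅x⁆ x)) ,
             λ x∈ → lookup x≢xs (∈-fromList⁻ xs x∈) refl

  subsingleton⇒∣p∣≤1 : ∀ (p : Subset n) → (∀ {x y} → x ∈ p → y ∈ p → x ≡ y) → ∣ p ∣ ≤ 1
  subsingleton⇒∣p∣≤1 p equal with nonempty? p
  ... | yes (x , x∈p) = ≤-trans
    (p⊆q⇒∣p∣≤∣q∣ λ y∈p → subst (_∈ ⁅ x ⁆) (equal x∈p y∈p) (x∈⁅x⁆ x))
    (≤-reflexive (∣⁅x⁆∣≡1 x))
  ... | no empty rewrite Empty-unique empty = ≤-trans (≤-reflexive (∣⊥∣≡0 n)) z≤n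

module _ (G : Graph) where
  open Graph G

  ∈-N[]⁻ : ∀ v {u} → u ∈ N[_] G v → u ≡ v ⊎ Adj v u
  ∈-N[]⁻ v {u} u∈ = does-true ((u ≟ v) ⊎-dec adj? v u)
    (trans (sym (lookup∘tabulate _ u)) ([]=⇒lookup u∈))
    where
    does-true : ∀ {P : Set} (P? : Dec P) → does P? ≡ true → P
    does-true (yes p) _ = p

  IsPath : List Vertex → Set
  IsPath xs = Unique xs × Linked Adj xs

  IsPath-++⁻ˡ : ∀ xs {ys} → IsPath (xs ++ ys) → IsPath xs
  IsPath-++⁻ˡ xs (unique , linked) = AllPairs-++⁻ˡ xs unique , Linked-++⁻ˡ xs linked

  IsPath-++⁻ʳ : ∀ xs {ys} → IsPath (xs ++ ys) → IsPath ys
  IsPath-++⁻ʳ xs (unique , linked) = AllPairs-++⁻ʳ xs unique , Linked-++⁻ʳ xs linked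

  module _ (g : ℕ) (g≤cycle : ∀ c → IsCycle G c → g ≤ length c) where

    -- The edge from `w` to `u` closes the path to a cycle; an interior vertex supplies the third
    -- vertex that a cycle must have.
    closed-path-length : ∀ {u w} ms → IsPath (u ∷ ms ++ [ w ]) → 1 ≤ length ms →
                         Adj w u → g ≤ 2 + length ms
    closed-path-length {u} {w} ms (unique , linked) 1≤ wu =
      subst (g ≤_) length≡ (g≤cycle _
        (subst (3 ≤_) (sym length≡) (s≤s (s≤s 1≤)) , unique , Linked-∷ʳ⁺ (u ∷ ms) linked wu))
      where
      length≡ : length (u ∷ ms ++ [ w ]) ≡ 2 + length ms
      length≡ = cong suc (length-++-[] ms)

    -- Putting `v` in front gives a path from `v` to `w` with nonempty interior `u ∷ ms`, which the
    -- edge from `w` to `v` closes.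
    coned-path-length : ∀ {u v w} ms → IsPath (u ∷ ms ++ [ w ]) → v ∉ˡ u ∷ ms ++ [ w ] →
                        Adj v u → Adj w v → g ≤ 3 + length ms
    coned-path-length {u} ms (unique , linked) v∉ vu wv =
      closed-path-length (u ∷ ms) (All.¬Any⇒All¬ _ v∉ ∷ unique , vu ∷ linked) (s≤s z≤n) wv

    -- The upper bound makes the segment too short to be closed even through one extra vertex, as
    -- that cycle has only `3 + length ms` vertices. The lower bound ensures that an interior vertex
    -- has another interior vertex on at least one side.
    Separated : Vertex → Vertex → Set
    Separated u w = ∃ λ ms → IsPath (u ∷ ms ++ [ w ]) × 2 ≤ length ms × 4 + length ms ≤ g

    Separated⇒≢ : ∀ {u w} → Separated u w → u ≢ w
    Separated⇒≢ (ms , (u≢ ∷ _ , _) , _) = lookup u≢ (∈-++⁺ʳ ms (here refl))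

    Separated⇒¬Adj : ∀ {u w} → Separated u w → ¬ Adj w u
    Separated⇒¬Adj (ms , path , 2≤ , <g) wu =
      <⇒≱ (≤-trans (n≤1+n _) <g)
          (closed-path-length ms path (≤-trans (s≤s z≤n) 2≤) wu)

    Separated⇒no-common-neighbour : ∀ {u v w} → Separated u w → Adj v u → ¬ Adj v w
    Separated⇒no-common-neighbour {u} {v} {w} (ms , path , 2≤ , <g) vu vw
      with _∈?_ _≟_ v (u ∷ ms ++ [ w ])
    -- This is the tight case: the cycle has `3 + length ms` vertices, just one below what `<g`
    -- allows for `g`.
    ... | no v∉            = <⇒≱ <g (coned-path-length ms path v∉ vu (adj-sym vw))
    ... | yes (here refl)  = adj-irrefl v vu
    ... | yes (there v∈) with ∈-++⁻ ms v∈
    ... | inj₂ (here refl) = adj-irrefl v vw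
    ... | inj₁ v∈ms with ∈-∃++ v∈ms
    -- Some vertex lies between `u` and `v`, so the edge from `v` to `u` closes the initial part
    -- `u ∷ ps ++ [ v ]`.
    ... | ps@(_ ∷ _) , qs , refl =
      <⇒≱ (≤-trans (+-monoʳ-≤ 3 ps≤) (≤-trans (n≤1+n _) <g))
          (closed-path-length ps left (s≤s z≤n) vu)
      where
      ps≤ : length ps ≤ length (ps ++ v ∷ qs)
      ps≤ = ≤-trans (m≤m+n _ _) (≤-reflexive (sym (length-++ ps)))
      regroup : (ps ++ v ∷ qs) ++ [ w ] ≡ (ps ++ [ v ]) ++ qs ++ [ w ]
      regroup = trans (++-assoc ps (v ∷ qs) [ w ])
                      (sym (++-assoc ps [ v ] (qs ++ [ w ])))
      left : IsPath (u ∷ ps ++ [ v ])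
      left = IsPath-++⁻ˡ (u ∷ ps ++ [ v ]) (subst IsPath (cong (u ∷_) regroup) path)
    -- Here `v` comes right after `u`, so the initial part is a single edge; the final part from `v`
    -- to `w` is closed instead.
    ... | [] , qs@(_ ∷ _) , refl =
      <⇒≱ (≤-trans (n≤1+n _) (≤-trans (n≤1+n _) <g))
          (closed-path-length qs (IsPath-++⁻ʳ [ u ] path) (s≤s z≤n) (adj-sym vw))
    -- With `v` as the only interior vertex neither part would close to a cycle; `2≤` excludes this.
    ... | [] , [] , refl with s≤s () ← 2≤

    Separated⇒¬N[] : ∀ {u v w} → Separated u w → u ∈ N[_] G v → ¬ w ∈ N[_] G v
    Separated⇒¬N[] {u} {v} {w} sep u∈ w∈ with ∈-N[]⁻ v u∈ | ∈-N[]⁻ v w∈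
    ... | inj₁ refl | inj₁ refl = Separated⇒≢ sep refl
    ... | inj₁ refl | inj₂ uw   = Separated⇒¬Adj sep (adj-sym uw)
    ... | inj₂ wu   | inj₁ refl = Separated⇒¬Adj sep wu
    ... | inj₂ vu   | inj₂ vw   = Separated⇒no-common-neighbour sep vu vw

    -- The induction drops three vertices at a time while `g` stays fixed, hence an inequality
    -- between `length xs` and `g`.
    thirds-separated : ∀ xs → IsPath xs → length xs ≤ g → AllPairs Separated (thirds xs)
    thirds-separated []           _ _ = []
    thirds-separated (_ ∷ [])     _ _ = []
    thirds-separated (_ ∷ _ ∷ []) _ _ = []
    thirds-separated (x ∷ y ∷ z ∷ xs) path ≤g =
      tabulate separated ∷
      thirds-separated xs (IsPath-++⁻ʳ (x ∷ y ∷ z ∷ []) path) (≤-trans (m≤n+m _ 3) ≤g)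
      where
      separated : ∀ {w} → w ∈ˡ thirds xs → Separated x w
      separated {w} w∈ with ps , qs , refl , 2≤ ← ∈-thirds xs w∈ =
        y ∷ z ∷ ps ,
        IsPath-++⁻ˡ (x ∷ y ∷ z ∷ ps ++ [ w ])
          (subst IsPath (cong (λ l → x ∷ y ∷ z ∷ l) (sym (++-assoc ps [ w ] qs))) path) ,
        s≤s (s≤s z≤n) ,
        ≤-trans bound ≤g
        where
        open ≤-Reasoning
        -- The left side is `4 + length (y ∷ z ∷ ps)`. The right side counts `x`, `y`, `z`, `ps`,
        -- `w` and the at least two vertices of `qs`.
        bound : 6 + length ps ≤ 3 + length (ps ++ w ∷ qs)
        bound = begin
          6 + length ps                     ≡⟨ cong (3 +_) (+-comm 3 (length ps)) ⟩
          3 + (length ps + 3)               ≤⟨ +-monoʳ-≤ 3 (+-monoʳ-≤ (length ps) (s≤s 2≤)) ⟩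
          3 + (length ps + suc (length qs)) ≡⟨ cong (3 +_) (length-++ ps) ⟨
          3 + length (ps ++ w ∷ qs)         ∎

    separated-packing : ∀ {xs} → AllPairs Separated xs → Is1LimitedPacking G (fromList xs)
    separated-packing {xs} seps v = subsingleton⇒∣p∣≤1 _ equal
      where
      equal : ∀ {x y} → x ∈ _ → y ∈ _ → x ≡ y
      equal x∈ y∈ with x∈p∩q⁻ (N[_] G v) _ x∈ | x∈p∩q⁻ (N[_] G v) _ y∈
      ... | xN , xB | yN , yB
        with AllPairs-lookup seps (∈-fromList⁻ xs xB) (∈-fromList⁻ xs yB)
      ... | inj₁ x≡y        = x≡y
      ... | inj₂ (inj₁ sep) = contradiction yN (Separated⇒¬N[] sep xN)
      ... | inj₂ (inj₂ sep) = contradiction xN (Separated⇒¬N[] sep yN)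

  girth/3≤L₁ : ∀ c → girth G c / 3 ≤ L₁ G
  girth/3≤L₁ c with girth G c | girth-isGirth G c
  -- Abstracting `girth G c` lets `refl` identify `g` with the length of a shortest cycle.
  ... | g | (x ∷ xs , (_ , unique , linked) , refl) , minimal = begin
    length (x ∷ xs) / 3      ≡⟨ length-thirds (x ∷ xs) ⟨
    length (thirds (x ∷ xs)) ≤⟨ length≤∣fromList∣ distinct ⟩
    ∣ fromList (thirds (x ∷ xs)) ∣
      ≤⟨ proj₂ (L₁-isMax G) _ (_ , separated-packing g g≤cycle separated , refl) ⟩
    L₁ G                     ∎
    where
    open ≤-Reasoning
    g≤cycle : ∀ c → IsCycle G c → g ≤ length c
    g≤cycle c cycle = minimal _ (c , cycle , refl)
    separated : AllPairs (Separated g g≤cycle) (thirds (x ∷ xs))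
    -- Dropping the repeated `x` from the closed list leaves a path through all `g` vertices.
    separated = thirds-separated g g≤cycle (x ∷ xs)
      (unique , Linked-++⁻ˡ (x ∷ xs) linked) ≤-refl
    distinct : Unique (thirds (x ∷ xs))
    distinct = AllPairs.map (Separated⇒≢ g g≤cycle) separated

K₃ : Graph
K₃ = record
  { order      = 3
  ; nontrivial = s≤s (s≤s z≤n)
  ; Adj        = _≢_
  ; adj?       = λ u v → ¬? (u ≟ v)
  ; adj-sym    = ≢-sym
  ; adj-irrefl = λ _ v≢v → v≢v refl
  }

K₃-cycle : ContainsCycle K₃
K₃-cycle = triangle , from-yes (isCycle? K₃ triangle)
  where
  triangle = zero ∷ suc zero ∷ suc (suc zero) ∷ []

theorem3p7 : ((G : Graph) (c : ContainsCycle G) → girth G c / 3 ≤ L₁ G)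
    × (Σ Graph λ G → Σ (ContainsCycle G) λ c → L₁ G ≡ girth G c / 3)
-- In `K₃` every closed neighbourhood is the whole vertex set, so a packing has at most one vertex;
-- both bounded searches evaluate, and each side reduces to 1.
theorem3p7 = girth/3≤L₁ , K₃ , K₃-cycle , refl
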